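{- For every graph $G$, $\alpha^\circ(G)\le \chi_c(G)$.
   Context: All graphs are finite, undirected and simple. The length of a cycle is its number of vertices. Circular altitude. A circular ordering $\sigma$ of the vertex set $V(G)$ of a graph $G$ is a one-to-one assignment of $V(G)$ to the vertices of a directed cycle. A cycle $u_1,u_2,\ldots,u_n$ of $G$ is monotonic for $\sigma$ if $u_1,\ldots,u_n,u_1$ appear in this circular order in $\sigma$. The circular altitude $\alpha^\circ(G)$ is the largest $k$ such that every circular ordering of $V(G)$ contains a monotonic cycle of length at least $k$. For this definition edges are considered as monotonic cycles of length two, so the circular altitude is at least $2$ for any graph with at least one edge. Circular chromatic number. For positive integers $p$ and $q$, a colouring $c:V(G)\to\{1,\ldots,p\}$ of $G$ is called a $(p,q)$-colouring if $q\le |c(x)-c(y)|\le p-q$ for all adjacent vertices $x$ and $y$. The circular chromatic number of $G$ is $\chi_c(G)=\inf\{p/q : \text{there is a }(p,q)\text{ -colouring of }G\}$. -}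

module Defs where

open import Level using (0ℓ)
open import Data.Fin using (Fin; zero; suc; toℕ; inject₁)
open import Data.Fin.Properties
  using (all?; any?; nonZeroIndex; injective⇒≤; toℕ-injective; inject₁-injective; toℕ<n)
  renaming (_≟_ to _≟ᶠ_)
open import Data.Integer using (+_)
open import Data.List using (List; []; _∷_; _∷ʳ_; length; map; lookup)
open import Data.List.Properties using (map-cong)
open import Data.List.Membership.Propositional.Properties using (∈-lookup)
open import Data.List.Relation.Unary.All as All using ([]; _∷_)
open import Data.List.Relation.Unary.AllPairs using ([]; _∷_)
open import Data.List.Relation.Unary.Linked using (Linked; linked?)
open import Data.List.Relation.Unary.Unique.Propositional using (Unique)
import Data.List.Relation.Unary.Unique.DecPropositional as DecUnique
open import Data.Nat
  using (ℕ; zero; suc; _+_; _∸_; _%_; _≤_; _<_; z≤n; s≤s; NonZero; ∣_-_∣; _≤?_; _<?_)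
import Data.Nat.Properties as ℕ
open import Data.Product using (∃; ∃₂; _×_; _,_; proj₁; proj₂)
open import Data.Rational as ℚ using (ℚ; 0ℚ; _/_)
import Data.Rational.Properties as ℚ
open import Data.Sum using (_⊎_; inj₁; inj₂)
open import Data.Vec.Functional using () renaming (_∷_ to _∷ᵛ_)
open import Function using (_↣_; mk↣; Injective; Injection; _∘_; id)
open import Relation.Binary using (Rel; Symmetric; Irreflexive)
  renaming (Decidable to Decidable₂)
open import Relation.Binary.PropositionalEquality
  using (_≡_; _≗_; refl; cong; subst)
  renaming (sym to ≡-sym)
open import Relation.Nullary using (¬_; Dec; yes; no; contradiction)
open import Relation.Nullary.Decidable using (map′; _×-dec_; _→-dec_; _⊎-dec_)
open import Relation.Unary using (Pred; Decidable)

record Graph : Set₁ where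
  field
    order  : ℕ
    Adj    : Rel (Fin order) 0ℓ
    sym    : Symmetric Adj
    irrefl : Irreflexive _≡_ Adj
    adj?   : Decidable₂ Adj

  V : Set
  V = Fin order

open Graph using (V)

-- The target Fin n is the vertex set of the directed cycle
-- 0 → 1 → ⋯ → n-1 → 0.  Both sides have n elements, so one-to-one
-- assignments are automatically bijective.
CircularOrdering : Graph → Set
CircularOrdering G = V G ↣ Fin (Graph.order G)

-- Number of arcs traversed when walking from a to b along the directed
-- cycle 0 → 1 → ⋯ → n-1 → 0.
arcs : ∀ {n} → Fin n → Fin n → ℕ
arcs {n} a b = (toℕ b + (n ∸ toℕ a)) % n
  where instance _ = nonZeroIndex a

-- u ∷ us lists the vertices of a cycle of G.  Length two is admitted: such
-- a "cycle" is exactly an edge.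
IsCycle : (G : Graph) → V G → List (V G) → Set
IsCycle G u us =
  2 ≤ length (u ∷ us) × Unique (u ∷ us) × Linked (Graph.Adj G) (u ∷ us ∷ʳ u)

-- Starting at u and going once around the directed cycle, one meets the
-- vertices u ∷ us in this order before returning to u.
IsMonotonic : ∀ {n} → (Fin n → Fin n) → Fin n → List (Fin n) → Set
IsMonotonic σ u us = Linked _<_ (map (λ v → arcs (σ u) (σ v)) (u ∷ us))

HasMonotonicCycle : (G : Graph) → (V G → V G) → ℕ → Set
HasMonotonicCycle G σ k =
  ∃₂ λ u us → IsCycle G u us × IsMonotonic σ u us × k ≤ length (u ∷ us)

Unavoidable : Graph → ℕ → Set
Unavoidable G k = (σ : CircularOrdering G) → HasMonotonicCycle G (Injection.to σ) k

-- k is the largest element of P, or 0 if P is empty.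
IsMaxOrZero : Pred ℕ 0ℓ → ℕ → Set
IsMaxOrZero P k = (P k × (∀ j → P j → j ≤ k)) ⊎ ((∀ j → ¬ P j) × k ≡ 0)

-- The zero case arises precisely for edgeless graphs, which have no cycles
-- even in the extended sense; their circular chromatic number, as defined
-- below, is inf {1/q} = 0 too.
IsCircularAltitude : Graph → ℕ → Set
IsCircularAltitude G = IsMaxOrZero (Unavoidable G)

private

  allFun? : ∀ {n} m {P : (Fin m → Fin n) → Set} →
            (∀ {f g} → f ≗ g → P f → P g) → (∀ f → Dec (P f)) → Dec (∀ f → P f)
  allFun? zero resp P? =
    map′ (λ p f → resp (λ ()) p) (λ h → h _) (P? λ ())
  allFun? (suc m) {P} resp P? =
    map′ (λ h f → resp (η f) (h (f zero) (f ∘ suc))) (λ h x g → h (x ∷ᵛ g))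
      (all? λ x → allFun? m {λ g → P (x ∷ᵛ g)} (resp ∘ ∷-cong x) (λ g → P? (x ∷ᵛ g)))
    where
    η : ∀ f → (f zero ∷ᵛ (f ∘ suc)) ≗ f
    η f zero    = refl
    η f (suc i) = refl
    ∷-cong : ∀ x {f g : Fin m → Fin _} → f ≗ g → (x ∷ᵛ f) ≗ (x ∷ᵛ g)
    ∷-cong x eq zero    = refl
    ∷-cong x eq (suc i) = eq i

  anyList? : ∀ {n} b {P : List (Fin n) → Set} → (∀ xs → Dec (P xs)) →
             Dec (∃ λ xs → length xs ≤ b × P xs)
  anyList? zero P? =
    map′ (λ p → [] , z≤n , p) (λ { ([] , _ , p) → p }) (P? [])
  anyList? (suc b) P? =
    map′ (λ { (inj₁ p) → [] , z≤n , p
            ; (inj₂ (x , xs , l , p)) → x ∷ xs , s≤s l , p })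
         (λ { ([] , _ , p) → inj₁ p
            ; (x ∷ xs , s≤s l , p) → inj₂ (x , xs , l , p) })
         (P? [] ⊎-dec any? λ x → anyList? b (λ xs → P? (x ∷ xs)))

  unique-lookup : ∀ {A : Set} {xs : List A} → Unique xs → Injective _≡_ _≡_ (lookup xs)
  unique-lookup (x∉ ∷ u) {zero}  {zero}  eq = refl
  unique-lookup (x∉ ∷ u) {zero}  {suc j} eq = contradiction eq (All.lookup x∉ (∈-lookup j))
  unique-lookup (x∉ ∷ u) {suc i} {zero}  eq =
    contradiction (≡-sym eq) (All.lookup x∉ (∈-lookup i))
  unique-lookup (x∉ ∷ u) {suc i} {suc j} eq = cong suc (unique-lookup u eq)

  unique⇒length≤ : ∀ {n} {xs : List (Fin n)} → Unique xs → length xs ≤ n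
  unique⇒length≤ u = injective⇒≤ (unique-lookup u)

  module _ (G : Graph) where
    open Graph G hiding (V)

    hasMonotonicCycle? : ∀ σ k → Dec (HasMonotonicCycle G σ k)
    hasMonotonicCycle? σ k =
      map′ (λ { (u , us , _ , h) → u , us , h })
           (λ { (u , us , h@((_ , uniq , _) , _)) →
                u , us , ℕ.≤-trans (ℕ.n≤1+n _) (unique⇒length≤ uniq) , h })
           (any? λ u → anyList? order λ us →
             ((2 ≤? _) ×-dec DecUnique.unique? _≟ᶠ_ _ ×-dec linked? adj? _)
             ×-dec linked? _<?_ _ ×-dec (k ≤? _))

    hasMonotonicCycle-resp : ∀ {σ τ k} → σ ≗ τ →
      HasMonotonicCycle G σ k → HasMonotonicCycle G τ k
    hasMonotonicCycle-resp {σ} {τ} eq (u , us , c , m , l) =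
      u , us , c , subst (Linked _<_) (map-cong arcs-cong (u ∷ us)) m , l
      where
      arcs-cong : ∀ v → arcs (σ u) (σ v) ≡ arcs (τ u) (τ v)
      arcs-cong v rewrite eq u | eq v = refl

    injective? : (f : Fin order → Fin order) → Dec (∀ x y → f x ≡ f y → x ≡ y)
    injective? f = all? λ x → all? λ y → (f x ≟ᶠ f y) →-dec (x ≟ᶠ y)

    unavoidable? : Decidable (Unavoidable G)
    unavoidable? k =
      map′ (λ h σ → h (Injection.to σ) (λ x y → Injection.injective σ))
           (λ h f inj → h (mk↣ (λ {x} {y} → inj x y)))
           (allFun? order
             (λ {f} {g} eq h inj → hasMonotonicCycle-resp eq (h λ x y fx≡fy →
               inj x y (subst (_≡ g y) (eq x) (subst (f x ≡_) (eq y) fx≡fy))))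
             (λ f → injective? f →-dec hasMonotonicCycle? f k))

    unavoidable⇒≤order : ∀ {k} → Unavoidable G k → k ≤ order
    unavoidable⇒≤order h with h (mk↣ {to = id} id)
    ... | _ , _ , (_ , uniq , _) , _ , l = ℕ.≤-trans l (unique⇒length≤ uniq)

  maxOrZero : ∀ {P : Pred ℕ 0ℓ} → Decidable P → ∀ b → (∀ j → P j → j ≤ b) →
              ∃ (IsMaxOrZero P)
  maxOrZero P? b bd with P? b
  ... | yes p = b , inj₁ (p , bd)
  maxOrZero {P} P? zero bd | no ¬p =
    0 , inj₂ ((λ j p → ¬p (subst P (ℕ.n≤0⇒n≡0 (bd j p)) p)) , refl)
  maxOrZero {P} P? (suc b) bd | no ¬p = maxOrZero P? b λ j p →
    ℕ.≤-pred (ℕ.≤∧≢⇒< (bd j p) λ j≡ → ¬p (subst P j≡ p))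

circularAltitude : (G : Graph) → ∃ (IsCircularAltitude G)
circularAltitude G =
  maxOrZero (unavoidable? G) (Graph.order G) (λ _ → unavoidable⇒≤order G)

α° : Graph → ℕ
α° G = proj₁ (circularAltitude G)

-- Real numbers as upper Dedekind cuts: above r holds when the real number
-- is strictly smaller than r.
-- Classically these are exactly the real numbers; constructively, they are
-- the notion for which inhabited, bounded-below sets of rationals have
-- infima without any further assumption.
record ℝᵘ : Set₁ where
  field
    above     : Pred ℚ 0ℓ
    inhabited : ∃ above
    bounded   : ∃ λ b → ∀ r → above r → b ℚ.< r
    upward    : ∀ {r s} → above r → r ℚ.< s → above s
    rounded   : ∀ {s} → above s → ∃ λ r → r ℚ.< s × above r

open ℝᵘ using (above)

infix 4 _≤ᵘ_

_≤ᵘ_ : Rel ℝᵘ 0ℓ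
x ≤ᵘ y = ∀ {r} → above y r → above x r

fromℚ : ℚ → ℝᵘ
fromℚ x = record
  { above     = x ℚ.<_
  ; inhabited = x ℚ.+ ℚ.1ℚ , subst (ℚ._< x ℚ.+ ℚ.1ℚ) (ℚ.+-identityʳ x)
                                (ℚ.+-monoʳ-< x (ℚ.positive⁻¹ ℚ.1ℚ))
  ; bounded   = x , λ _ x<r → x<r
  ; upward    = ℚ.<-trans
  ; rounded   = λ x<s → let (r , x<r , r<s) = ℚ.<-dense x<s in r , r<s , x<r
  }

fromℕ : ℕ → ℝᵘ
fromℕ n = fromℚ (+ n / 1)

IsInfimum : Pred ℚ 0ℓ → ℝᵘ → Set₁
IsInfimum S x =
  (∀ s → S s → x ≤ᵘ fromℚ s) × (∀ y → (∀ s → S s → y ≤ᵘ fromℚ s) → y ≤ᵘ x)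

infimum : (S : Pred ℚ 0ℓ) → ∃ S → (∃ λ b → ∀ s → S s → b ℚ.≤ s) → ∃ (IsInfimum S)
infimum S (s₀ , s₀∈S) (b , b≤S) = inf ,
  (λ s s∈S s<r → s , s∈S , s<r) ,
  (λ y y≤S (s , s∈S , s<r) → y≤S s s∈S s<r)
  where
  inf : ℝᵘ
  inf = record
    { above     = λ r → ∃ λ s → S s × s ℚ.< r
    ; inhabited = let (r , s₀<r) = ℝᵘ.inhabited (fromℚ s₀) in r , s₀ , s₀∈S , s₀<r
    ; bounded   = b , λ _ (s , s∈S , s<r) → ℚ.≤-<-trans (b≤S s s∈S) s<r
    ; upward    = λ (s , s∈S , s<r) r<t → s , s∈S , ℚ.<-trans s<r r<t
    ; rounded   = λ (s , s∈S , s<t) →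
        let (r , s<r , r<t) = ℚ.<-dense s<t in r , r<t , s , s∈S , s<r
    }

-- Colours are 0, …, p-1 rather than 1, …, p.  The upper bound
-- |c(x) - c(y)| ≤ p - q is written without subtraction.
IsColouring : (G : Graph) (p q : ℕ) → (V G → Fin p) → Set
IsColouring G p q c = ∀ {x y} → Graph.Adj G x y →
  let d = ∣ toℕ (c x) - toℕ (c y) ∣ in q ≤ d × d + q ≤ p

data ColouringRatio (G : Graph) : Pred ℚ 0ℓ where
  ratio : ∀ p q .{{_ : NonZero p}} .{{_ : NonZero q}} (c : V G → Fin p) →
          IsColouring G p q c → ColouringRatio G (+ p / q)

private

  someColouringRatio : (G : Graph) → ∃ (ColouringRatio G)
  someColouringRatio G = _ , ratio (suc order) 1 inject₁ λ {x} {y} xy →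
      ℕ.n≢0⇒n>0 (λ d≡0 → irrefl (inject₁-injective (toℕ-injective (ℕ.∣m-n∣≡0⇒m≡n d≡0))) xy)
    , subst (_≤ suc order) (ℕ.+-comm 1 _)
        (s≤s (ℕ.≤-trans (ℕ.∣m-n∣≤m⊔n (toℕ (inject₁ x)) (toℕ (inject₁ y)))
          (ℕ.⊔-lub (ℕ.≤-pred (toℕ<n (inject₁ x))) (ℕ.≤-pred (toℕ<n (inject₁ y))))))
    where open Graph G

  colouringRatio≥0 : (G : Graph) → ∀ s → ColouringRatio G s → 0ℚ ℚ.≤ s
  colouringRatio≥0 G _ (ratio p q _ _) =
    ℚ.nonNegative⁻¹ (+ p / q) {{ℚ.normalize-nonNeg p q}}

circularChromaticNumber : (G : Graph) → ∃ (IsInfimum (ColouringRatio G))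
circularChromaticNumber G =
  infimum (ColouringRatio G) (someColouringRatio G) (0ℚ , colouringRatio≥0 G)

χc : Graph → ℝᵘ
χc G = proj₁ (circularChromaticNumber G)

{-# OPTIONS --safe #-}

-- Given a (p,q)-colouring c, order the vertices circularly by colour, breaking
-- ties arbitrarily.  Going once around the circle along a monotonic cycle raises
-- the colour by p altogether, modulo which every edge raises it by at least q.
-- A monotonic cycle of length k thus has k q ≤ p, whence α° ≤ p / q.
module Submission where

open import Data.Bool.Properties using (T-≡)
open import Data.Fin using (Fin; toℕ; fromℕ<; combine)
open import Data.Fin.Properties
  using (toℕ-injective; toℕ-fromℕ<; toℕ<n; nonZeroIndex; combine-injectiveʳ; combine-monoˡ-<)
open import Data.Fin.Subset using (Subset; _∈_; _∉_; ∣_∣)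
open import Data.Fin.Subset.Properties using (p⊂q⇒∣p∣<∣q∣; ∣⊤∣≡n; ∈⊤)
open import Data.Integer as ℤ using (+_; +≤+)
open import Data.Integer.Properties using (pos-*)
open import Data.List using (_∷_; []; _∷ʳ_; length; map)
open import Data.List.Relation.Unary.Linked using (Linked; _∷_)
open import Data.Nat
  using (ℕ; suc; _+_; _*_; _∸_; _%_; _≤_; _<_; z≤n; NonZero; ∣_-_∣; _<ᵇ_)
open import Data.Nat.DivMod using (m<n⇒m%n≡m; [m+n]%n≡m%n)
open import Data.Nat.Properties
open import Data.Product using (∃; _,_; proj₁; proj₂)
open import Data.Rational as ℚ using (_/_)
import Data.Rational.Properties as ℚ
import Data.Rational.Unnormalised as ℚᵘ
import Data.Rational.Unnormalised.Properties as ℚᵘ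
open import Data.Sum using (inj₁; inj₂)
open import Data.Vec using (tabulate)
open import Data.Vec.Properties using ([]=⇒lookup; lookup⇒[]=; lookup∘tabulate)
open import Function using (Equivalence; Injective; Injection; _↣_; mk↣)
open import Relation.Binary using (tri<; tri≈; tri>)
open import Relation.Binary.PropositionalEquality
open import Relation.Nullary using (yes; no; contradiction)
open import Defs

open Graph using (V)

-- With `arcs-<`, this removes the remainder: adding the start turns arc counts into positions on
-- the unrolled cycle, where vertices past the wrap are moved up by `n`.
arcs-≥ : ∀ {n} (a b : Fin n) → toℕ a ≤ toℕ b → toℕ a + arcs a b ≡ toℕ b
arcs-≥ {n} a b a≤b = begin
  toℕ a + (toℕ b + (n ∸ toℕ a)) % n ≡⟨ cong (λ x → toℕ a + x % n) (+-∸-assoc (toℕ b) (<⇒≤ (toℕ<n a))) ⟨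
  toℕ a + (toℕ b + n ∸ toℕ a) % n   ≡⟨ cong (λ x → toℕ a + x % n) (+-∸-comm n a≤b) ⟩
  toℕ a + (toℕ b ∸ toℕ a + n) % n   ≡⟨ cong (λ x → toℕ a + x) ([m+n]%n≡m%n (toℕ b ∸ toℕ a) n) ⟩
  toℕ a + (toℕ b ∸ toℕ a) % n
    ≡⟨ cong (λ x → toℕ a + x) (m<n⇒m%n≡m (≤-<-trans (m∸n≤m (toℕ b) (toℕ a)) (toℕ<n b))) ⟩
  toℕ a + (toℕ b ∸ toℕ a)           ≡⟨ m+[n∸m]≡n a≤b ⟩
  toℕ b                             ∎
  where
  open ≡-Reasoning
  instance _ = nonZeroIndex a

arcs-< : ∀ {n} (a b : Fin n) → toℕ b < toℕ a → toℕ a + arcs a b ≡ toℕ b + n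
arcs-< {n} a b b<a = begin
  toℕ a + (toℕ b + (n ∸ toℕ a)) % n ≡⟨ cong (λ x → toℕ a + x) (m<n⇒m%n≡m small) ⟩
  toℕ a + (toℕ b + (n ∸ toℕ a))     ≡⟨ cong (λ x → toℕ a + x) (+-∸-assoc (toℕ b) a≤n) ⟨
  toℕ a + (toℕ b + n ∸ toℕ a)       ≡⟨ m+[n∸m]≡n (≤-trans a≤n (m≤n+m n (toℕ b))) ⟩
  toℕ b + n                         ∎
  where
  open ≡-Reasoning
  instance _ = nonZeroIndex a
  a≤n : toℕ a ≤ n
  a≤n = <⇒≤ (toℕ<n a)
  small : toℕ b + (n ∸ toℕ a) < n
  small = subst (toℕ b + (n ∸ toℕ a) <_) (m+[n∸m]≡n a≤n) (+-monoˡ-< (n ∸ toℕ a) b<a)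

module _ {n} (key : Fin n → ℕ) where

  below : Fin n → Subset n
  below i = tabulate λ j → key j <ᵇ key i

  ∈-below⁺ : ∀ {i j} → key j < key i → j ∈ below i
  ∈-below⁺ {i} {j} lt = lookup⇒[]= j (below i)
    (trans (lookup∘tabulate _ j) (Equivalence.to T-≡ (<⇒<ᵇ lt)))

  ∈-below⁻ : ∀ {i j} → j ∈ below i → key j < key i
  ∈-below⁻ {i} {j} j∈ = <ᵇ⇒< (key j) (key i) (Equivalence.from T-≡
    (trans (sym (lookup∘tabulate _ j)) ([]=⇒lookup j∈)))

  below-irrefl : ∀ i → i ∉ below i
  below-irrefl i i∈ = <-irrefl refl (∈-below⁻ i∈)

  -- Counting smaller keys compresses them to positions in `Fin n`; the count stays below `n`
  -- because `i` is not below itself.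
  rank : Fin n → Fin n
  rank i = fromℕ< (subst (∣ below i ∣ <_) (∣⊤∣≡n n)
    (p⊂q⇒∣p∣<∣q∣ ((λ _ → ∈⊤) , i , ∈⊤ , below-irrefl i)))

  rank-mono-< : ∀ {i j} → key i < key j → toℕ (rank i) < toℕ (rank j)
  rank-mono-< {i} {j} lt = subst₂ _<_ (sym (toℕ-fromℕ< _)) (sym (toℕ-fromℕ< _))
    (p⊂q⇒∣p∣<∣q∣ ((λ k∈ → ∈-below⁺ (<-trans (∈-below⁻ k∈) lt))
                 , i , ∈-below⁺ lt , below-irrefl i))

  rank-injective : Injective _≡_ _≡_ key → Injective _≡_ _≡_ rank
  rank-injective key-inj {i} {j} eq with <-cmp (key i) (key j)
  ... | tri< lt _ _ = contradiction (cong toℕ eq) (<⇒≢ (rank-mono-< lt))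
  ... | tri≈ _ ki≡kj _ = key-inj ki≡kj
  ... | tri> _ _ gt = contradiction (cong toℕ (sym eq)) (<⇒≢ (rank-mono-< gt))

sortingOrder : ∀ {n p} (c : Fin n → Fin p) → ∃ λ (σ : Fin n ↣ Fin n) →
  ∀ v w → toℕ (Injection.to σ v) ≤ toℕ (Injection.to σ w) → toℕ (c v) ≤ toℕ (c w)
sortingOrder c =
  mk↣ (rank-injective key λ {i} {j} eq → combine-injectiveʳ (c i) i (c j) j (toℕ-injective eq)) ,
  λ v w σv≤σw → ≮⇒≥ λ cw<cv → ≤⇒≯ σv≤σw (rank-mono-< key (combine-monoˡ-< w v cw<cv))
  where
  -- Lexicographic code: the colour decides first, and the index breaks ties and makes the key
  -- injective.
  key = λ i → toℕ (combine (c i) i)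

module _ (G : Graph) {p q} {c : V G → Fin p} (colouring : IsColouring G p q c)
         {σ : V G → V G} (sorted : ∀ v w → toℕ (σ v) ≤ toℕ (σ w) → toℕ (c v) ≤ toℕ (c w))
         where
  open Graph G using (Adj; order)

  private
    col pos : V G → ℕ
    col v = toℕ (c v)
    pos v = toℕ (σ v)

  -- Sortedness fixes the sign of the colour difference, so the lower bound `q` on the distance
  -- becomes a rise.
  edge-ascends : ∀ {v w} → Adj v w → pos v ≤ pos w → col v + q ≤ col w
  edge-ascends {v} {w} vw le = begin
    col v + q                 ≤⟨ +-monoʳ-≤ (col v) (proj₁ (colouring vw)) ⟩
    col v + ∣ col v - col w ∣ ≡⟨ cong (λ x → col v + x) (m≤n⇒∣m-n∣≡n∸m cv≤cw) ⟩
    col v + (col w ∸ col v)   ≡⟨ m+[n∸m]≡n cv≤cw ⟩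
    col w                     ∎
    where
    open ≤-Reasoning
    cv≤cw = sorted v w le

  -- The distance is at most `p - q`, so lifting the far end by `p` gains at least `q`, whichever
  -- colour is larger.
  edge-wraps : ∀ {v w} → Adj v w → col v + q ≤ col w + p
  edge-wraps {v} {w} vw = begin
    col v + q                         ≤⟨ +-monoˡ-≤ q (m≤n+∣m-n∣ (col v) (col w)) ⟩
    (col w + ∣ col v - col w ∣) + q   ≡⟨ +-assoc (col w) _ q ⟩
    col w + (∣ col v - col w ∣ + q)   ≤⟨ +-monoʳ-≤ (col w) (proj₂ (colouring vw)) ⟩
    col w + p                         ∎
    where open ≤-Reasoning

  shift : ∀ {x y} → x + q ≤ y → (x + p) + q ≤ y + p
  shift {x} {y} le = begin
    (x + p) + q ≡⟨ +-assoc x p q ⟩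
    x + (p + q) ≡⟨ cong (λ z → x + z) (+-comm p q) ⟩
    x + (q + p) ≡⟨ +-assoc x q p ⟨
    (x + q) + p ≤⟨ +-monoˡ-≤ p le ⟩
    y + p       ∎
    where open ≤-Reasoning

  module _ (u : V G) where

    -- The colour lifted to the universal cover of the circle: p is added to it
    -- once the walk from u has passed from position order - 1 to position 0.
    lift : V G → ℕ
    lift v with pos u ≤? pos v
    ... | yes _ = col v
    ... | no  _ = col v + p

    lift-start : lift u ≡ col u
    lift-start with pos u ≤? pos u
    ... | yes _ = refl
    ... | no u≰u = contradiction ≤-refl u≰u

    lift-step : ∀ {v w} → Adj v w → arcs (σ u) (σ v) < arcs (σ u) (σ w) →
                lift v + q ≤ lift w
    lift-step {v} {w} vw lt with pos u ≤? pos v | pos u ≤? pos w | +-monoʳ-< (pos u) lt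
    -- Adding `pos u` to both arc counts compares unrolled positions, hence `pos v < pos w` here.
    ... | yes u≤v | yes u≤w | lt′ =
      edge-ascends vw (<⇒≤ (subst₂ _<_ (arcs-≥ _ _ u≤v) (arcs-≥ _ _ u≤w) lt′))
    ... | yes _   | no _    | _ = edge-wraps vw
    -- Here `v` would come after the wrap and `w` before it, giving `pos v + order < pos w < order`.
    ... | no u≰v  | yes u≤w | lt′ = contradiction
      (<-trans (subst₂ _<_ (arcs-< _ _ (≰⇒> u≰v)) (arcs-≥ _ _ u≤w) lt′) (toℕ<n (σ w)))
      (m+n≮n (pos v) order)
    ... | no u≰v  | no u≰w  | lt′ = shift (edge-ascends vw (<⇒≤ (+-cancelʳ-< order _ _
      (subst₂ _<_ (arcs-< _ _ (≰⇒> u≰v)) (arcs-< _ _ (≰⇒> u≰w)) lt′))))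

    -- The closing edge ends at the copy of `u` one full turn later, at height `col u + p` rather
    -- than `lift u`.
    lift-close : ∀ {v} → Adj v u → lift v + q ≤ col u + p
    lift-close {v} vu with pos u ≤? pos v
    ... | yes _  = edge-wraps vu
    ... | no u≰v = shift (edge-ascends vu (<⇒≤ (≰⇒> u≰v)))

    -- Each listed vertex accounts for the edge leaving it, the last one for the closing edge; every
    -- such edge contributes `q`.
    lift-path : ∀ v vs → Linked Adj (v ∷ vs ∷ʳ u) →
                Linked _<_ (map (λ x → arcs (σ u) (σ x)) (v ∷ vs)) →
                lift v + length (v ∷ vs) * q ≤ col u + p
    lift-path v [] (vu ∷ _) _ =
      subst (λ x → lift v + x ≤ col u + p) (sym (*-identityˡ q)) (lift-close vu)
    lift-path v (w ∷ ws) (vw ∷ adj) (lt ∷ mono) = begin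
      lift v + (q + length (w ∷ ws) * q) ≡⟨ +-assoc (lift v) q _ ⟨
      (lift v + q) + length (w ∷ ws) * q ≤⟨ +-monoˡ-≤ _ (lift-step vw lt) ⟩
      lift w + length (w ∷ ws) * q       ≤⟨ lift-path w ws adj mono ⟩
      col u + p                          ∎
      where open ≤-Reasoning

  monotonicCycle-bound : ∀ {k} → HasMonotonicCycle G σ k → k * q ≤ p
  monotonicCycle-bound (u , us , (_ , _ , adj) , mono , k≤) =
    ≤-trans (*-monoˡ-≤ q k≤) (+-cancelˡ-≤ (col u) _ _
      (subst (λ x → x + length (u ∷ us) * q ≤ col u + p) (lift-start u)
        (lift-path u u us adj mono)))

altitude-bound : ∀ G {k p q} {c : V G → Fin p} →
  IsCircularAltitude G k → IsColouring G p q c → k * q ≤ p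
altitude-bound G {c = c} (inj₁ (unavoidable , _)) colouring =
  let (σ , sorted) = sortingOrder c
  in monotonicCycle-bound G {c = c} colouring sorted (unavoidable σ)
altitude-bound G (inj₂ (_ , refl)) _ = z≤n

k*q≤p⇒k≤p/q : ∀ k p q .{{_ : NonZero q}} → k * q ≤ p → + k / 1 ℚ.≤ + p / q
k*q≤p⇒k≤p/q k p (suc q) le = ℚ.toℚᵘ-cancel-≤ (begin
  -- Unnormalised fractions compare by cross-multiplication. `mkℚᵘ` takes the denominator minus one,
  -- so `0` encodes 1 and `q` encodes `suc q`.
  ℚ.toℚᵘ (+ k / 1)     ≃⟨ ℚ.toℚᵘ-fromℚᵘ (ℚᵘ.mkℚᵘ (+ k) 0) ⟩
  ℚᵘ.mkℚᵘ (+ k) 0      ≤⟨ ℚᵘ.*≤* (subst₂ ℤ._≤_ (pos-* k (suc q)) (pos-* p 1)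
                            (+≤+ (subst (k * suc q ≤_) (sym (*-identityʳ p)) le))) ⟩
  ℚᵘ.mkℚᵘ (+ p) q      ≃⟨ ℚ.toℚᵘ-fromℚᵘ (ℚᵘ.mkℚᵘ (+ p) q) ⟨
  ℚ.toℚᵘ (+ p / suc q) ∎)
  where open ℚᵘ.≤-Reasoning

theorem1p3 : (G : Graph) → fromℕ (α° G) ≤ᵘ χc G
-- Membership of `r` in the cut of the infimum supplies an actual colouring with ratio below `r`, so
-- no limit is taken.
theorem1p3 G (_ , ratio p q c colouring , p/q<r) =
  ℚ.≤-<-trans
    (k*q≤p⇒k≤p/q (α° G) p q (altitude-bound G {c = c} (proj₂ (circularAltitude G)) colouring))
    p/q<r
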